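{- Fix an integer $k\ge 3$. For every rational number $\alpha\in[0,1)$, there exists a finite family $\mathcal{F}$ of $k$-graphs such that $\gamma(\mathcal{F})=\alpha$.
   Context: A $k$-graph ($k$-uniform hypergraph) $H$ consists of a vertex set $V(H)$ and an edge set $E(H)\subseteq\binom{V(H)}{k}$. For a $(k-1)$-subset $S\subseteq V(H)$, $d_H(S)$ is the number of edges of $H$ containing $S$. The minimum codegree $\delta_{k-1}(H)$ is the minimum of $d_H(S)$ over all $(k-1)$-subsets $S$ of $V(H)$. For a family $\mathcal{F}$ of $k$-graphs, a $k$-graph is $\mathcal{F}$-free if it contains no member of $\mathcal{F}$ as a (not necessarily induced) subgraph. The codegree Turán number $\mathrm{co\text{ - }ex}(n,\mathcal{F})$ is the maximum of $\delta_{k-1}(H)$ over all $n$-vertex $\mathcal{F}$-free $k$-graphs $H$, and the codegree Turán density is $\gamma(\mathcal{F})=\lim_{n\to\infty}\mathrm{co\text{ - }ex}(n,\mathcal{F})/n$ (this limit is known to exist for every family $\mathcal{F}$). -}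

module Defs where

open import Data.Nat using (ℕ; zero; suc; _+_; _∸_; _≤_)
open import Data.Bool using (Bool; true; false; if_then_else_)
open import Data.Fin using (Fin)
open import Data.Fin.Subset using (Subset; ∣_∣; _∪_; ⁅_⁆; _∈_; _∉_)
open import Data.Vec using (lookup)
open import Data.List using (List; map; allFin)
open import Data.Nat.ListAction using (sum)
open import Data.List.Membership.Propositional renaming (_∈_ to _∈ₗ_)
open import Data.Product using (Σ; ∃; ∃-syntax; _×_; _,_)
open import Function.Definitions using (Injective)
open import Relation.Binary.PropositionalEquality using (_≡_)
open import Relation.Nullary using (¬_)

record KGraph (k n : ℕ) : Set where
  field
    edge    : Subset n → Bool
    uniform : ∀ S → edge S ≡ true → ∣ S ∣ ≡ k
open KGraph public

_⊑_ : ∀ {k m n} → KGraph k m → KGraph k n → Set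
_⊑_ {k} {m} {n} F H =
  Σ (Fin m → Fin n) λ f → Injective _≡_ _≡_ f ×
    (∀ (S : Subset m) → edge F S ≡ true →
       ∀ (T : Subset n) →
         (∀ j → (j ∈ T → ∃[ i ] (i ∈ S × f i ≡ j)) × (∀ i → i ∈ S → f i ∈ T)) →
         edge H T ≡ true)

Family : ℕ → Set
Family k = List (Σ ℕ (KGraph k))

Free : ∀ {k n} → Family k → KGraph k n → Set
Free {k} 𝓕 H = ∀ {m} (F : KGraph k m) → (m , F) ∈ₗ 𝓕 → ¬ (F ⊑ H)

-- d_H(S): number of edges of H containing S, for S a (k-1)-set; each such
-- edge is S ∪ {v} for exactly one vertex v ∉ S.
codeg : ∀ {k n} → KGraph k n → Subset n → ℕ
codeg {k} {n} H S =
  sum (map (λ v → if lookup S v then 0 else (if edge H (S ∪ ⁅ v ⁆) then 1 else 0))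
           (allFin n))

MinCodegAtLeast : ∀ {k n} → KGraph k n → ℕ → Set
MinCodegAtLeast {k} {n} H c = ∀ (S : Subset n) → ∣ S ∣ ≡ k ∸ 1 → c ≤ codeg H S

MinCodegAtMost : ∀ {k n} → KGraph k n → ℕ → Set
MinCodegAtMost {k} {n} H c = ∃[ S ] (∣ S ∣ ≡ k ∸ 1 × codeg H S ≤ c)

CoEx : ∀ {k} → Family k → ℕ → ℕ → Set
CoEx {k} 𝓕 n c =
  (∃[ H ] (Free 𝓕 H × MinCodegAtLeast {k} {n} H c)) ×
  (∀ (H : KGraph k n) → Free 𝓕 H → MinCodegAtMost H c)

{-# OPTIONS --safe #-}

-- Write α = d/q with g = q - d ≥ 2 (d and q are both doubled).  Call x bad for c
-- when x ∈ {c, …, c+g-1} in ℤ/q, and let 𝓕 consist of all k-graphs on M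
-- vertices having no q-colouring in which no edge has the form x…x c with x bad
-- for c.  Colouring Fin n by residues and taking all k-sets not of this form
-- gives an 𝓕-free k-graph with minimum codegree dn/q - O(1).
--
-- Conversely, let H have minimum codegree at least dn/q + O(1).  Given a
-- colouring of a bounded set W of vertices, let T be the set of colours used at
-- least k-1 times, and for each y ∈ ℤ/q choose a monochromatic (k-1)-set S_y in W
-- whose colour is the last element of T at or before y.  On average a vertex lies
-- in the neighbourhoods of more than d of the q sets S_y, so many vertices do; but
-- a vertex coloured from T lies in at most d of them.  Adding enough such vertices,
-- for every colouring of W at once, forces every colouring of the enlarged set to
-- use one more colour at least k-1 times.  After q+1 rounds no colouring is left,
-- and the size of the set depends only on k and q.

module Submission where

open import Defs
open import Data.Bool using (Bool; true; false; if_then_else_; _∧_)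
open import Data.Bool.Properties using () renaming (_≟_ to _≟ᵇ_)
open import Data.Nat using (ℕ; zero; suc; _+_; _*_; _∸_; _^_; _≤_; _<_; z≤n; s≤s; _≤?_; _<?_; NonZero) renaming (_≟_ to _≟ⁿ_)
open import Data.Nat.Properties hiding (_≟_; suc-injective; 0≢1+n)
open import Data.Nat.DivMod using (_%_; _/_; _mod_; m%n<n; m%n%n≡m%n; m<n⇒m%n≡m; %-distribˡ-+; [m+n]%n≡m%n; [m+kn]%n≡m%n; m≡m%n+[m/n]*n)
open import Data.Fin using (Fin; zero; suc; toℕ; fromℕ<; _↑ˡ_; _↑ʳ_; combine; quotient; finToFun; funToFin)
open import Data.Fin.Properties using (_≟_; any?; all?; suc-injective; toℕ-injective; toℕ-fromℕ<; toℕ<n; pigeonhole; finToFun-funToFin; remQuot-combine; combine-injectiveʳ; ↑ʳ-injective; ↑ˡ-injective; 0≢1+n)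
open import Data.Fin.Subset using (Subset; inside; outside; ∣_∣; _∪_; ∁; ⊥; ⊤; ⁅_⁆; _∈_; _∉_; _⊆_; Nonempty)
open import Data.Fin.Subset.Properties
open import Data.Vec using ([]; _∷_; here; there; lookup; tabulate)
open import Data.Vec.Properties using (lookup⇒[]=; []=⇒lookup; lookup∘tabulate; tabulate-cong)
open import Data.List using (List; []; _∷_; allFin; filter; cartesianProductWith) renaming (map to mapₗ; tabulate to tabulateₗ)
open import Data.List.Properties using (map-tabulate; map-cong)
open import Data.Nat.ListAction using () renaming (sum to sumₗ)
open import Algebra.Properties.CommutativeMonoid.Sum +-0-commutativeMonoid using (sum; sum-cong-≗; ∑-comm; ∑-distrib-+)
open import Data.Product using (Σ; ∃; ∃-syntax; _×_; _,_; proj₁; proj₂)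
open import Data.Sum using (_⊎_; inj₁; inj₂)
open import Function using (_∘_; id; case_of_)
open import Function.Definitions using (Injective)
open import Relation.Binary.PropositionalEquality
open import Relation.Nullary using (¬_; Dec; yes; no; contradiction; ⌊_⌋)
open import Relation.Nullary.Decidable using (_×-dec_; _→-dec_; ¬?; map′; decidable-stable)
open import Data.List.Membership.Propositional using (lose) renaming (_∈_ to _∈ₗ_)
open import Data.List.Membership.Propositional.Properties using (∈-map⁺; ∈-map⁻; ∈-filter⁺; ∈-filter⁻; ∈-cartesianProductWith⁺)
open import Data.List.Relation.Unary.Any as Any using (Any; here; there)
import Data.List.Relation.Unary.All as All
open import Data.Nat.Solver using (module +-*-Solver)
open +-*-Solver using (solve; con; _:+_; _:*_; _:=_)

private variable
  m n k : ℕ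

-- Finite subsets, their sizes and their images.

comprehension : {P : Fin n → Set} → (∀ i → Dec (P i)) → Subset n
comprehension P? = tabulate (λ i → ⌊ P? i ⌋)

module _ {P : Fin n → Set} (P? : ∀ i → Dec (P i)) where

  ∈-comprehension⁺ : ∀ {i} → P i → i ∈ comprehension P?
  ∈-comprehension⁺ {i} p = lookup⇒[]= i _ (trans (lookup∘tabulate _ i) (helper (P? i)))
    where
    helper : (D : Dec (P i)) → ⌊ D ⌋ ≡ true
    helper (yes _) = refl
    helper (no ¬p) = contradiction p ¬p

  ∈-comprehension⁻ : ∀ {i} → i ∈ comprehension P? → P i
  ∈-comprehension⁻ {i} i∈ = helper (P? i) (trans (sym (lookup∘tabulate _ i)) ([]=⇒lookup i∈))
    where
    helper : (D : Dec (P i)) → ⌊ D ⌋ ≡ true → P i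
    helper (yes p) _ = p

∣∁p∣+∣p∣≡n : ∀ (p : Subset n) → ∣ ∁ p ∣ + ∣ p ∣ ≡ n
∣∁p∣+∣p∣≡n {n} p = trans (cong (_+ ∣ p ∣) (∣∁p∣≡n∸∣p∣ p)) (m∸n+n≡m (∣p∣≤n p))

∣p∪⁅x⁆∣≡1+∣p∣ : ∀ {p : Subset n} {x} → x ∉ p → ∣ p ∪ ⁅ x ⁆ ∣ ≡ suc ∣ p ∣
∣p∪⁅x⁆∣≡1+∣p∣ {p = inside  ∷ p} {zero}  x∉p = contradiction here x∉p
∣p∪⁅x⁆∣≡1+∣p∣ {p = outside ∷ p} {zero}  x∉p = cong (suc ∘ ∣_∣) (∪-identityʳ p)
∣p∪⁅x⁆∣≡1+∣p∣ {p = inside  ∷ p} {suc x} x∉p = cong suc (∣p∪⁅x⁆∣≡1+∣p∣ (x∉p ∘ there))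
∣p∪⁅x⁆∣≡1+∣p∣ {p = outside ∷ p} {suc x} x∉p = ∣p∪⁅x⁆∣≡1+∣p∣ (x∉p ∘ there)

∣p∪q∣≤∣p∣+∣q∣ : ∀ (p r : Subset n) → ∣ p ∪ r ∣ ≤ ∣ p ∣ + ∣ r ∣
∣p∪q∣≤∣p∣+∣q∣ []            []            = z≤n
∣p∪q∣≤∣p∣+∣q∣ (inside  ∷ p) (s       ∷ r) =
  s≤s (≤-trans (∣p∪q∣≤∣p∣+∣q∣ p r) (+-monoʳ-≤ ∣ p ∣ (∣p∣≤∣x∷p∣ s r)))
∣p∪q∣≤∣p∣+∣q∣ (outside ∷ p) (inside  ∷ r) =
  ≤-trans (s≤s (∣p∪q∣≤∣p∣+∣q∣ p r)) (≤-reflexive (sym (+-suc ∣ p ∣ ∣ r ∣)))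
∣p∪q∣≤∣p∣+∣q∣ (outside ∷ p) (outside ∷ r) = ∣p∪q∣≤∣p∣+∣q∣ p r

subset-of-size : ∀ (p : Subset n) → k ≤ ∣ p ∣ → ∃[ r ] (r ⊆ p × ∣ r ∣ ≡ k)
subset-of-size {n} {zero} p k≤ = ⊥ , (λ x∈⊥ → contradiction x∈⊥ ∉⊥) , ∣⊥∣≡0 n
subset-of-size {k = suc k} (inside ∷ p) (s≤s k≤)
  with r , r⊆p , eq ← subset-of-size p k≤ = inside ∷ r , s⊆s r⊆p , cong suc eq
subset-of-size {k = suc k} (outside ∷ p) k≤
  with r , r⊆p , eq ← subset-of-size p k≤ = outside ∷ r , s⊆s r⊆p , eq

image : (Fin m → Fin n) → Subset m → Subset n
image f []            = ⊥
image f (inside  ∷ p) = image (f ∘ suc) p ∪ ⁅ f zero ⁆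
image f (outside ∷ p) = image (f ∘ suc) p

∈-image⁺ : ∀ (f : Fin m → Fin n) {p i} → i ∈ p → f i ∈ image f p
∈-image⁺ f here = q⊆p∪q _ _ (x∈⁅x⁆ (f zero))
∈-image⁺ f {inside  ∷ p} (there i∈p) = p⊆p∪q _ (∈-image⁺ (f ∘ suc) i∈p)
∈-image⁺ f {outside ∷ p} (there i∈p) = ∈-image⁺ (f ∘ suc) i∈p

∈-image⁻ : ∀ (f : Fin m → Fin n) p {j} → j ∈ image f p → ∃[ i ] (i ∈ p × f i ≡ j)
∈-image⁻ f [] j∈ = contradiction j∈ ∉⊥
∈-image⁻ f (inside ∷ p) {j} j∈ with x∈p∪q⁻ (image (f ∘ suc) p) _ j∈
... | inj₁ j∈p with i , i∈p , eq ← ∈-image⁻ (f ∘ suc) p j∈p = suc i , there i∈p , eq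
... | inj₂ j∈s = zero , here , sym (x∈⁅y⁆⇒x≡y _ j∈s)
∈-image⁻ f (outside ∷ p) j∈ with i , i∈p , eq ← ∈-image⁻ (f ∘ suc) p j∈ = suc i , there i∈p , eq

∣image∣≡∣p∣ : ∀ {f : Fin m → Fin n} → Injective _≡_ _≡_ f → ∀ p → ∣ image f p ∣ ≡ ∣ p ∣
∣image∣≡∣p∣ {n = n} inj [] = ∣⊥∣≡0 n
∣image∣≡∣p∣ {f = f} inj (inside ∷ p) = trans (∣p∪⁅x⁆∣≡1+∣p∣ fresh) (cong suc (∣image∣≡∣p∣ (suc-injective ∘ inj) p))
  where
  fresh : f zero ∉ image (f ∘ suc) p
  fresh f0∈ with i , _ , eq ← ∈-image⁻ (f ∘ suc) p f0∈ = 0≢1+n (sym (inj eq))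
∣image∣≡∣p∣ inj (outside ∷ p) = ∣image∣≡∣p∣ (suc-injective ∘ inj) p

∣image∣≤∣p∣ : ∀ (f : Fin m → Fin n) p → ∣ image f p ∣ ≤ ∣ p ∣
∣image∣≤∣p∣ {n = n} f [] = ≤-reflexive (∣⊥∣≡0 n)
∣image∣≤∣p∣ f (inside ∷ p) = begin
  ∣ image (f ∘ suc) p ∪ ⁅ f zero ⁆ ∣        ≤⟨ ∣p∪q∣≤∣p∣+∣q∣ (image (f ∘ suc) p) ⁅ f zero ⁆ ⟩
  ∣ image (f ∘ suc) p ∣ + ∣ ⁅ f zero ⁆ ∣    ≤⟨ +-mono-≤ (∣image∣≤∣p∣ (f ∘ suc) p) (≤-reflexive (∣⁅x⁆∣≡1 (f zero))) ⟩
  ∣ p ∣ + 1                                 ≡⟨ +-comm ∣ p ∣ 1 ⟩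
  suc ∣ p ∣                                 ∎
  where open ≤-Reasoning
∣image∣≤∣p∣ f (outside ∷ p) = ∣image∣≤∣p∣ (f ∘ suc) p

-- Sums of indicators and double counting.

⟦_⟧ : Bool → ℕ
⟦ b ⟧ = if b then 1 else 0

sum-mono-≤ : ∀ {f g : Fin n → ℕ} → (∀ i → f i ≤ g i) → sum f ≤ sum g
sum-mono-≤ {zero}  f≤g = z≤n
sum-mono-≤ {suc n} f≤g = +-mono-≤ (f≤g zero) (sum-mono-≤ (f≤g ∘ suc))

sum-const : ∀ n c → sum {n} (λ _ → c) ≡ n * c
sum-const zero    c = refl
sum-const (suc n) c = cong (c +_) (sum-const n c)

sum-*ˡ : ∀ c (f : Fin n → ℕ) → sum (λ i → c * f i) ≡ c * sum f
sum-*ˡ {zero}  c f = sym (*-zeroʳ c)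
sum-*ˡ {suc n} c f = trans (cong (c * f zero +_) (sum-*ˡ c (f ∘ suc))) (sym (*-distribˡ-+ c (f zero) _))

sum-⟦⟧ : ∀ (p : Fin n → Bool) → sum (⟦_⟧ ∘ p) ≡ ∣ tabulate p ∣
sum-⟦⟧ {zero}  p = refl
sum-⟦⟧ {suc n} p with p zero
... | true  = cong suc (sum-⟦⟧ (p ∘ suc))
... | false = sum-⟦⟧ (p ∘ suc)

sum-lookup : ∀ (p : Subset n) → sum (λ i → ⟦ lookup p i ⟧) ≡ ∣ p ∣
sum-lookup []            = refl
sum-lookup (inside  ∷ p) = cong suc (sum-lookup p)
sum-lookup (outside ∷ p) = sum-lookup p

indicesOf : (Fin m → Subset n) → Fin n → Subset m
indicesOf A v = tabulate (λ i → lookup (A i) v)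

∈-indicesOf⁻ : ∀ (A : Fin m → Subset n) {i v} → i ∈ indicesOf A v → v ∈ A i
∈-indicesOf⁻ A {i} {v} i∈ = lookup⇒[]= v _ (trans (sym (lookup∘tabulate _ i)) ([]=⇒lookup i∈))

popular : ℕ → (Fin m → Subset n) → Subset n
popular d A = comprehension (λ v → d <? ∣ indicesOf A v ∣)

-- Pairs `(i , v)` with `v` in `A i` are counted in two ways: each index contributes at least `c`,
-- while a vertex contributes at most `d` if it is unpopular and at most `m` otherwise.
∣popular∣-lower-bound : ∀ {c} d (A : Fin m → Subset n) → (∀ i → c ≤ ∣ A i ∣) →
                        m * c ≤ n * d + m * ∣ popular d A ∣
∣popular∣-lower-bound {m} {n} {c} d A c≤ = begin
  m * c                                                  ≡⟨ sum-const m c ⟨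
  sum {m} (λ _ → c)                                      ≤⟨ sum-mono-≤ c≤ ⟩
  sum (λ i → ∣ A i ∣)                                    ≡⟨ sum-cong-≗ (λ i → sum-lookup (A i)) ⟨
  sum (λ i → sum (λ v → ⟦ lookup (A i) v ⟧))             ≡⟨ ∑-comm (λ i v → ⟦ lookup (A i) v ⟧) ⟩
  sum (λ v → sum (λ i → ⟦ lookup (A i) v ⟧))             ≡⟨ sum-cong-≗ (λ v → sum-⟦⟧ (λ i → lookup (A i) v)) ⟩
  sum (λ v → ∣ indicesOf A v ∣)                          ≤⟨ sum-mono-≤ pointwise ⟩
  sum (λ v → d + m * ⟦ pop v ⟧)                          ≡⟨ ∑-distrib-+ (λ _ → d) (λ v → m * ⟦ pop v ⟧) ⟩
  sum {n} (λ _ → d) + sum (λ v → m * ⟦ pop v ⟧)          ≡⟨ cong₂ _+_ (sum-const n d) (sum-*ˡ m (⟦_⟧ ∘ pop)) ⟩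
  n * d + m * sum (⟦_⟧ ∘ pop)                            ≡⟨ cong (λ s → n * d + m * s) (sum-⟦⟧ pop) ⟩
  n * d + m * ∣ popular d A ∣                            ∎
  where
  open ≤-Reasoning
  pop : Fin n → Bool
  pop v = ⌊ d <? ∣ indicesOf A v ∣ ⌋
  pointwise : ∀ v → ∣ indicesOf A v ∣ ≤ d + m * ⟦ pop v ⟧
  pointwise v with d <? ∣ indicesOf A v ∣
  ... | yes _ = ≤-trans (∣p∣≤n (indicesOf A v)) (≤-trans (≤-reflexive (sym (*-identityʳ m))) (m≤n+m _ d))
  ... | no d≮ = ≤-trans (≮⇒≥ d≮) (m≤m+n d _)

-- Otherwise `p` would lie in the image of `f`, which has at most `m` elements. With `m` equal to 0
-- or 1 this picks an element of a set, or one other than a given element.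
fresh-element : ∀ (f : Fin m → Fin n) (p : Subset n) → m < ∣ p ∣ → ∃[ v ] (v ∈ p × ∀ i → f i ≢ v)
fresh-element {m} f p m<∣p∣ with any? (λ v → (v ∈? p) ×-dec all? (λ i → ¬? (f i ≟ v)))
... | yes ∃v = ∃v
... | no ∄v = contradiction m<∣p∣ (≤⇒≯ (≤-trans (p⊆q⇒∣p∣≤∣q∣ p⊆image)
        (≤-trans (∣image∣≤∣p∣ f ⊤) (≤-reflexive (∣⊤∣≡n m)))))
  where
  p⊆image : p ⊆ image f ⊤
  p⊆image {v} v∈p with any? (λ i → f i ≟ v)
  ... | yes (i , refl) = ∈-image⁺ f ∈⊤
  ... | no ∄i = contradiction (v , v∈p , λ i eq → ∄i (i , eq)) ∄v

-- The new values come first, so that the old ones sit at indices N ↑ʳ j.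
extend-injection : ∀ N (f : Fin m → Fin n) → Injective _≡_ _≡_ f →
                   (P : Fin N → Subset n) → (∀ i → N + m ≤ ∣ P i ∣) →
                   Σ (Fin (N + m) → Fin n) λ h → Injective _≡_ _≡_ h ×
                     (∀ j → h (N ↑ʳ j) ≡ f j) × (∀ i → h (i ↑ˡ m) ∈ P i)
extend-injection zero f inj P big = f , inj , (λ _ → refl) , λ ()
extend-injection {m} {n} (suc N) f inj P big
  with h , h-inj , h-old , h-new ← extend-injection N f inj (P ∘ suc) (λ i → ≤-trans (n≤1+n _) (big (suc i)))
  with v , v∈P , h≢v ← fresh-element h (P zero) (big zero)
  = h′ , h′-inj , h-old , h′-new
  where
  h′ : Fin (suc N + m) → Fin n
  h′ zero    = v
  h′ (suc i) = h i
  h′-inj : Injective _≡_ _≡_ h′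
  h′-inj {zero}  {zero}  eq = refl
  h′-inj {zero}  {suc j} eq = contradiction (sym eq) (h≢v j)
  h′-inj {suc i} {zero}  eq = contradiction eq (h≢v i)
  h′-inj {suc i} {suc j} eq = cong suc (h-inj eq)
  h′-new : ∀ i → h′ (i ↑ˡ m) ∈ P i
  h′-new zero    = v∈P
  h′-new (suc i) = h-new i

-- Colour classes.

fibre : ∀ {q} → (Fin m → Fin q) → Fin q → Subset m
fibre χ x = comprehension (λ i → χ i ≟ x)

∈-fibre⁺ : ∀ {q} (χ : Fin m → Fin q) {x i} → χ i ≡ x → i ∈ fibre χ x
∈-fibre⁺ χ {x} = ∈-comprehension⁺ (λ i → χ i ≟ x)

∈-fibre⁻ : ∀ {q} (χ : Fin m → Fin q) {x i} → i ∈ fibre χ x → χ i ≡ x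
∈-fibre⁻ χ {x} = ∈-comprehension⁻ (λ i → χ i ≟ x)

∣fibre∘∣≤ : ∀ {q} (χ : Fin n → Fin q) {f : Fin m → Fin n} → Injective _≡_ _≡_ f →
            ∀ x → ∣ fibre (χ ∘ f) x ∣ ≤ ∣ fibre χ x ∣
∣fibre∘∣≤ χ {f} inj x = ≤-trans (≤-reflexive (sym (∣image∣≡∣p∣ inj (fibre (χ ∘ f) x)))) (p⊆q⇒∣p∣≤∣q∣ sub)
  where
  sub : image f (fibre (χ ∘ f) x) ⊆ fibre χ x
  sub j∈ with i , i∈ , refl ← ∈-image⁻ f (fibre (χ ∘ f) x) j∈ = ∈-fibre⁺ χ (∈-fibre⁻ (χ ∘ f) i∈)

fibre-cong : ∀ {q} {χ ψ : Fin m → Fin q} → χ ≗ ψ → ∀ x → fibre χ x ≡ fibre ψ x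
fibre-cong eq x = tabulate-cong (λ i → cong (λ c → ⌊ c ≟ x ⌋) (eq i))

-- Pigeonhole, read off from the double count for the singletons `⁅ χ i ⁆`: a popular colour is one
-- taken more than `k` times, and without any the count would give `q * suc k ≤ q * k`.
large-fibre : ∀ {q} k .{{_ : NonZero q}} (χ : Fin (q * suc k) → Fin q) → ∃[ x ] (suc k ≤ ∣ fibre χ x ∣)
large-fibre {q} k χ with any? (λ x → suc k ≤? ∣ fibre χ x ∣)
... | yes ∃x = ∃x
... | no ∄x = contradiction L≤ (<⇒≱ (*-monoʳ-< q ≤-refl))
  where
  open ≤-Reasoning
  A : Fin (q * suc k) → Subset q
  A i = ⁅ χ i ⁆
  unpopular : popular k A ⊆ ⊥
  unpopular {x} x∈ = contradiction (x , ≤-trans (∈-comprehension⁻ (λ v → k <? ∣ indicesOf A v ∣) x∈)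
    (p⊆q⇒∣p∣≤∣q∣ λ i∈ → ∈-fibre⁺ χ (sym (x∈⁅y⁆⇒x≡y _ (∈-indicesOf⁻ A i∈))))) ∄x
  L≤ : q * suc k ≤ q * k
  L≤ = begin
    q * suc k                                 ≡⟨ *-identityʳ _ ⟨
    q * suc k * 1                             ≤⟨ ∣popular∣-lower-bound k A (λ i → ≤-reflexive (sym (∣⁅x⁆∣≡1 (χ i)))) ⟩
    q * k + q * suc k * ∣ popular k A ∣       ≤⟨ +-monoʳ-≤ (q * k) (*-monoʳ-≤ (q * suc k) (p⊆q⇒∣p∣≤∣q∣ unpopular)) ⟩
    q * k + q * suc k * ∣ ⊥ {q} ∣             ≡⟨ cong (λ z → q * k + q * suc k * z) (∣⊥∣≡0 q) ⟩
    q * k + q * suc k * 0                     ≡⟨ cong (q * k +_) (*-zeroʳ (q * suc k)) ⟩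
    q * k + 0                                 ≡⟨ +-identityʳ _ ⟩
    q * k                                     ∎

-- Cyclic colours

least : ∀ {P : ℕ → Set} → (∀ i → Dec (P i)) → ∀ m → P m → ∃[ i ] (P i × ∀ j → P j → i ≤ j)
least P? m p with P? 0
... | yes p₀ = 0 , p₀ , λ _ _ → z≤n
least P? zero    p | no ¬p₀ = contradiction p ¬p₀
least {P} P? (suc m) p | no ¬p₀ with i , pᵢ , min ← least (P? ∘ suc) m p = suc i , pᵢ , min′
  where
  min′ : ∀ j → P j → suc i ≤ j
  min′ zero    p₀ = contradiction p₀ ¬p₀
  min′ (suc j) pⱼ = s≤s (min j pⱼ)

-- The predicate lives on all of ℕ so that shifting the window is a composition with `m +_`.
prefixCount : ℕ → (ℕ → Bool) → ℕ
prefixCount n P = ∣ tabulate {n = n} (P ∘ toℕ) ∣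

prefixCount-+ : ∀ m n P → prefixCount (m + n) P ≡ prefixCount m P + prefixCount n (P ∘ (m +_))
prefixCount-+ zero    n P = refl
prefixCount-+ (suc m) n P with P 0
... | true  = cong suc (prefixCount-+ m n (P ∘ suc))
... | false = prefixCount-+ m n (P ∘ suc)

module _ (q : ℕ) .{{_ : NonZero q}} where

  toℕ-mod : ∀ m → toℕ (m mod q) ≡ m % q
  toℕ-mod m = toℕ-fromℕ< (m%n<n m q)

  mod-cong : ∀ {m n} → m % q ≡ n % q → m mod q ≡ n mod q
  mod-cong {m} {n} eq = toℕ-injective (trans (toℕ-mod m) (trans eq (sym (toℕ-mod n))))

  mod-injective : ∀ {m n} → m mod q ≡ n mod q → m % q ≡ n % q
  mod-injective {m} {n} eq = trans (sym (toℕ-mod m)) (trans (cong toℕ eq) (toℕ-mod n))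

  toℕ-% : ∀ (x : Fin q) → toℕ x % q ≡ toℕ x
  toℕ-% x = m<n⇒m%n≡m (toℕ<n x)

  toℕ-mod-toℕ : ∀ (x : Fin q) → toℕ x mod q ≡ x
  toℕ-mod-toℕ x = toℕ-injective (trans (toℕ-mod (toℕ x)) (toℕ-% x))

  %-+-congˡ : ∀ {m n} k → m % q ≡ n % q → (m + k) % q ≡ (n + k) % q
  %-+-congˡ {m} {n} k eq = trans (%-distribˡ-+ m k q)
    (trans (cong (λ z → (z + k % q) % q) eq) (sym (%-distribˡ-+ n k q)))

  -- Adding `k * q ∸ k` to both sides turns the summand `k` into `k * q`, which vanishes modulo `q`.
  %-+-cancelʳ : ∀ {m n} k → (m + k) % q ≡ (n + k) % q → m % q ≡ n % q
  %-+-cancelʳ {m} {n} k eq = begin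
    m % q                            ≡⟨ rotate m ⟩
    (m + k + (k * q ∸ k)) % q        ≡⟨ %-+-congˡ (k * q ∸ k) eq ⟩
    (n + k + (k * q ∸ k)) % q        ≡⟨ rotate n ⟨
    n % q                            ∎
    where
    open ≡-Reasoning
    rotate : ∀ m → m % q ≡ (m + k + (k * q ∸ k)) % q
    rotate m = sym (trans (cong (_% q) (trans (+-assoc m k _)
      (cong (m +_) (m+[n∸m]≡n (m≤m*n k q))))) ([m+kn]%n≡m%n m k q))

  prefixCount-periodic : ∀ {P} → (∀ i → P (q + i) ≡ P i) →
                         ∀ t r → t * prefixCount q P ≤ prefixCount (t * q + r) P
  prefixCount-periodic per zero r = z≤n
  prefixCount-periodic {P} per (suc t) r = begin
    prefixCount q P + t * prefixCount q P                     ≤⟨ +-monoʳ-≤ _ (prefixCount-periodic per t r) ⟩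
    prefixCount q P + prefixCount (t * q + r) P               ≡⟨ cong (prefixCount q P +_) (cong ∣_∣ (tabulate-cong {n = t * q + r} (λ i → per (toℕ i)))) ⟨
    prefixCount q P + prefixCount (t * q + r) (P ∘ (q +_))    ≡⟨ prefixCount-+ q (t * q + r) P ⟨
    prefixCount (q + (t * q + r)) P                           ≡⟨ cong (λ z → prefixCount z P) (+-assoc q (t * q) r) ⟨
    prefixCount (q + t * q + r) P                             ∎
    where open ≤-Reasoning

  residue : Fin n → Fin q
  residue v = toℕ v mod q

  -- The first `n` integers contain `n / q` full periods, and every residue in `C` occurs in each of
  -- them.
  residues-in : ∀ n (C : Subset q) → (n / q) * ∣ C ∣ ≤ ∣ comprehension (λ (v : Fin n) → residue v ∈? C) ∣
  residues-in n C = begin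
    n / q * ∣ C ∣                              ≤⟨ *-monoʳ-≤ (n / q) (p⊆q⇒∣p∣≤∣q∣ λ {c} c∈C →
                                                   ∈-comprehension⁺ (λ (v : Fin q) → residue v ∈? C)
                                                     (subst (_∈ C) (sym (toℕ-mod-toℕ c)) c∈C)) ⟩
    n / q * prefixCount q P                    ≤⟨ prefixCount-periodic periodic (n / q) (n % q) ⟩
    prefixCount (n / q * q + n % q) P          ≡⟨ cong (λ z → prefixCount z P)
                                                   (trans (+-comm (n / q * q) _) (sym (m≡m%n+[m/n]*n n q))) ⟩
    prefixCount n P                            ∎
    where
    open ≤-Reasoning
    P : ℕ → Bool
    P i = ⌊ (i mod q) ∈? C ⌋
    periodic : ∀ i → P (q + i) ≡ P i
    periodic i = cong (λ z → ⌊ z ∈? C ⌋) (mod-cong (trans (cong (_% q) (+-comm q i)) ([m+n]%n≡m%n i q)))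

-- Bad pairs of colours on the cycle.

module Pattern (q g d : ℕ) .{{_ : NonZero q}} (2≤g : 2 ≤ g) (g+d≡q : g + d ≡ q) where

  g≤q : g ≤ q
  g≤q = subst (g ≤_) g+d≡q (m≤m+n g d)

  -- A (k-1)-set all of whose vertices have colour x may be completed to an
  -- edge by a vertex of colour c unless x is one of c, c+1, …, c+g-1 modulo q.
  Bad : Fin q → Fin q → Set
  Bad x c = ∃[ j ] ((toℕ c + toℕ {g} j) mod q ≡ x)

  bad? : ∀ x c → Dec (Bad x c)
  bad? x c = any? (λ j → (toℕ c + toℕ j) mod q ≟ x)

  bad-refl : ∀ x → Bad x x
  bad-refl x = fromℕ< 0<g , trans (mod-cong q (cong (_% q)
    (trans (cong (toℕ x +_) (toℕ-fromℕ< 0<g)) (+-identityʳ (toℕ x))))) (toℕ-mod-toℕ q x)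
    where
    0<g : 0 < g
    0<g = <⇒≤ 2≤g

  -- From `x = c + j` the colour `c` is recovered as `x - j`, so there is at most one for each
  -- `j < g`. The map `back` adds `q` to stay within ℕ.
  ∣bad∣≤g : ∀ x → ∣ comprehension (bad? x) ∣ ≤ g
  ∣bad∣≤g x = ≤-trans (p⊆q⇒∣p∣≤∣q∣ sub) (≤-trans (∣image∣≤∣p∣ back ⊤) (≤-reflexive (∣⊤∣≡n g)))
    where
    back : Fin g → Fin q
    back j = (toℕ x + (q ∸ toℕ j)) mod q
    sub : comprehension (bad? x) ⊆ image back ⊤
    sub {c} c∈ with j , refl ← ∈-comprehension⁻ (bad? x) c∈ =
      subst (_∈ image back ⊤) (trans (mod-cong q back-j) (toℕ-mod-toℕ q c)) (∈-image⁺ back (∈⊤ {x = j}))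
      where
      open ≡-Reasoning
      j≤q : toℕ j ≤ q
      j≤q = ≤-trans (<⇒≤ (toℕ<n j)) g≤q
      back-j : (toℕ ((toℕ c + toℕ j) mod q) + (q ∸ toℕ j)) % q ≡ toℕ c % q
      back-j = begin
        (toℕ ((toℕ c + toℕ j) mod q) + (q ∸ toℕ j)) % q  ≡⟨ %-+-congˡ q (q ∸ toℕ j) (trans (cong (_% q) (toℕ-mod q (toℕ c + toℕ j))) (m%n%n≡m%n (toℕ c + toℕ j) q)) ⟩
        (toℕ c + toℕ j + (q ∸ toℕ j)) % q                ≡⟨ cong (_% q) (trans (+-assoc (toℕ c) (toℕ j) _) (cong (toℕ c +_) (m+[n∸m]≡n j≤q))) ⟩
        (toℕ c + q) % q                                  ≡⟨ [m+n]%n≡m%n (toℕ c) q ⟩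
        toℕ c % q                                        ∎

  -- For each y take the last element of T met before or at y on the cycle;
  -- the g values y = c, …, c+g-1 then all lead to colours bad for c ∈ T.
  representatives : (T : Subset q) → Nonempty T →
    Σ (Fin q → Fin q) λ r → (∀ y → r y ∈ T) ×
      (∀ {c} → c ∈ T → ∀ p → (∀ {y} → y ∈ p → ¬ Bad (r y) c) → ∣ p ∣ ≤ d)
  representatives T (x₀ , x₀∈T) = r , r∈T , bound
    where
    Back : Fin q → ℕ → Set
    Back y i = ∃[ x ] (x ∈ T × (toℕ x + i) mod q ≡ y)
    -- Walking from `x₀` up to `q` and on to `y` gives some distance, from which the search for the
    -- least one can start.
    back₀ : ∀ y → Back y ((q ∸ toℕ x₀) + toℕ y)
    back₀ y = x₀ , x₀∈T , trans (mod-cong q (trans (cong (_% q) eq) ([m+n]%n≡m%n (toℕ y) q))) (toℕ-mod-toℕ q y)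
      where
      eq : toℕ x₀ + ((q ∸ toℕ x₀) + toℕ y) ≡ toℕ y + q
      eq = trans (sym (+-assoc (toℕ x₀) _ _)) (trans (cong (_+ toℕ y) (m+[n∸m]≡n (<⇒≤ (toℕ<n x₀)))) (+-comm q _))
    nearest : ∀ y → ∃[ i ] (Back y i × ∀ j → Back y j → i ≤ j)
    nearest y = least (λ i → any? (λ x → (x ∈? T) ×-dec ((toℕ x + i) mod q ≟ y))) _ (back₀ y)
    r : Fin q → Fin q
    r y = proj₁ (proj₁ (proj₂ (nearest y)))
    r∈T : ∀ y → r y ∈ T
    r∈T y = proj₁ (proj₂ (proj₁ (proj₂ (nearest y))))
    r-bad : ∀ {c} → c ∈ T → ∀ (j : Fin g) → Bad (r ((toℕ c + toℕ j) mod q)) c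
    r-bad {c} c∈T j with nearest ((toℕ c + toℕ j) mod q)
    ... | i , (x , x∈T , x+i) , min =
      fromℕ< i<g , trans (mod-cong q (trans (cong (λ z → (toℕ c + z) % q) (toℕ-fromℕ< i<g)) (sym x≡))) (toℕ-mod-toℕ q x)
      where
      -- `c` is itself in `T`, `j` steps behind this position. The nearest element `x` is no further
      -- behind, so it equals `c + (j - i)` with `j - i < g` and is bad for `c`.
      i≤j : i ≤ toℕ j
      i≤j = min (toℕ j) (c , c∈T , refl)
      i<g : toℕ j ∸ i < g
      i<g = ≤-<-trans (m∸n≤m (toℕ j) i) (toℕ<n j)
      x≡ : toℕ x % q ≡ (toℕ c + (toℕ j ∸ i)) % q
      x≡ = %-+-cancelʳ q i (trans (mod-injective q x+i)
        (cong (_% q) (sym (trans (+-assoc (toℕ c) _ i) (cong (toℕ c +_) (m∸n+n≡m i≤j))))))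
    bound : ∀ {c} → c ∈ T → ∀ p → (∀ {y} → y ∈ p → ¬ Bad (r y) c) → ∣ p ∣ ≤ d
    bound {c} c∈T p p-good = +-cancelˡ-≤ g ∣ p ∣ d (begin
      g + ∣ p ∣                    ≡⟨ +-comm g _ ⟩
      ∣ p ∣ + g                    ≡⟨ cong (∣ p ∣ +_) (trans (∣image∣≡∣p∣ step-inj ⊤) (∣⊤∣≡n g)) ⟨
      ∣ p ∣ + ∣ image step ⊤ ∣     ≤⟨ +-monoˡ-≤ _ (p⊆q⇒∣p∣≤∣q∣ p⊆) ⟩
      ∣ ∁ (image step ⊤) ∣ + ∣ image step ⊤ ∣ ≡⟨ trans (∣∁p∣+∣p∣≡n (image step ⊤)) (sym g+d≡q) ⟩
      g + d                        ∎)
      where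
      open ≤-Reasoning
      step : Fin g → Fin q
      step j = (toℕ c + toℕ j) mod q
      small : ∀ (j : Fin g) → toℕ j % q ≡ toℕ j
      small j = m<n⇒m%n≡m (<-≤-trans (toℕ<n j) g≤q)
      step-inj : Injective _≡_ _≡_ step
      step-inj {j} {j′} eq = toℕ-injective (trans (sym (small j)) (trans
        (%-+-cancelʳ q (toℕ c) (trans (cong (_% q) (+-comm (toℕ j) (toℕ c)))
          (trans (mod-injective q eq) (cong (_% q) (+-comm (toℕ c) (toℕ j′))))))
        (small j′)))
      -- The `g` distinct positions `c`, ..., `c + g - 1` all have bad representatives, so `p`
      -- avoids them and at most `d` positions remain.
      p⊆ : p ⊆ ∁ (image step ⊤)
      p⊆ {y} y∈p = x∉p⇒x∈∁p λ y∈im → helper y∈p (∈-image⁻ step ⊤ y∈im)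
        where
        helper : ∀ {y} → y ∈ p → ¬ (∃[ j ] (j ∈ ⊤ × step j ≡ y))
        helper y∈p (j , _ , refl) = p-good y∈p (r-bad c∈T j)

-- Decidability of the codegree Turán number

all-subsets? : {P : Subset n → Set} → (∀ S → Dec (P S)) → Dec (∀ S → P S)
all-subsets? P? = map′
  (λ ∄S S → decidable-stable (P? S) (λ ¬p → ∄S (S , ¬p)))
  (λ ∀S (S , ¬p) → ¬p (∀S S))
  (¬? (anySubset? (¬? ∘ P?)))

allFunctions : ∀ n → List (Subset n → Bool)
allFunctions zero    = (λ _ → true) ∷ (λ _ → false) ∷ []
allFunctions (suc n) = cartesianProductWith glue (allFunctions n) (allFunctions n)
  module AllFunctions where
  glue : (Subset n → Bool) → (Subset n → Bool) → Subset (suc n) → Bool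
  glue h₁ h₂ (inside  ∷ S) = h₁ S
  glue h₁ h₂ (outside ∷ S) = h₂ S

allFunctions-complete : ∀ (h : Subset n → Bool) → ∃[ h′ ] (h′ ∈ₗ allFunctions n × h′ ≗ h)
allFunctions-complete {zero} h with h [] in eq
... | true  = _ , here refl , λ { [] → sym eq }
... | false = _ , there (here refl) , λ { [] → sym eq }
allFunctions-complete {suc n} h
  with h₁ , h₁∈ , eq₁ ← allFunctions-complete (h ∘ (inside ∷_))
  with h₂ , h₂∈ , eq₂ ← allFunctions-complete (h ∘ (outside ∷_))
  = _ , ∈-cartesianProductWith⁺ (AllFunctions.glue n) h₁∈ h₂∈ , λ where
      (inside  ∷ S) → eq₁ S
      (outside ∷ S) → eq₂ S

-- The size test makes an arbitrary function uniform and changes nothing on the edge function of a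
-- `k`-graph.
kGraph : (Subset n → Bool) → KGraph k n
kGraph {k = k} h .edge S = ⌊ ∣ S ∣ ≟ⁿ k ⌋ ∧ h S
kGraph {k = k} h .uniform S e with ∣ S ∣ ≟ⁿ k
... | yes eq = eq

-- Only edges are compared, since the enumeration below reaches a graph up to pointwise equality of
-- its edge function.
_≈_ : KGraph k n → KGraph k n → Set
H ≈ H′ = ∀ S → edge H S ≡ edge H′ S

kGraph-edge : ∀ {H : KGraph k n} {h} → h ≗ edge H → kGraph h ≈ H
kGraph-edge {k = k} {H = H} {h} eq S with ∣ S ∣ ≟ⁿ k
... | yes _ = eq S
... | no ≢k with edge H S in e
...   | true  = contradiction (uniform H S e) ≢k
...   | false = refl

kGraphs : ∀ k n → List (KGraph k n)
kGraphs k n = mapₗ kGraph (allFunctions n)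

kGraphs-complete : ∀ (H : KGraph k n) → ∃[ H′ ] (H′ ∈ₗ kGraphs k n × H′ ≈ H)
kGraphs-complete H with h , h∈ , eq ← allFunctions-complete (edge H) =
  kGraph h , ∈-map⁺ kGraph h∈ , kGraph-edge {H = H} eq

⊑-resp-≈ : ∀ {F : KGraph k m} {H H′ : KGraph k n} → H ≈ H′ → F ⊑ H → F ⊑ H′
⊑-resp-≈ H≈H′ (f , inj , hom) =
  f , inj , λ S e T T=fS → trans (sym (H≈H′ T)) (hom S e T T=fS)

Free-resp-≈ : ∀ {𝓕 : Family k} {H H′ : KGraph k n} → H ≈ H′ → Free 𝓕 H → Free 𝓕 H′
Free-resp-≈ {H = H} {H′} H≈H′ free F F∈ F⊑H′ =
  free F F∈ (⊑-resp-≈ {F = F} {H′} {H} (λ S → sym (H≈H′ S)) F⊑H′)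

codeg-resp-≈ : ∀ {H H′ : KGraph k n} → H ≈ H′ → ∀ S → codeg H S ≡ codeg H′ S
codeg-resp-≈ {n = n} H≈H′ S = cong sumₗ (map-cong
  (λ v → cong (λ e → if lookup S v then 0 else (if e then 1 else 0)) (H≈H′ (S ∪ ⁅ v ⁆)))
  (allFin n))

neighbours : KGraph k n → Subset n → Subset n
neighbours H S = tabulate (λ v → if lookup S v then false else edge H (S ∪ ⁅ v ⁆))

∈-neighbours⁺ : ∀ {H : KGraph k n} {S v} → v ∉ S → edge H (S ∪ ⁅ v ⁆) ≡ true → v ∈ neighbours H S
∈-neighbours⁺ {H = H} {S} {v} v∉S e = lookup⇒[]= v _ (trans (lookup∘tabulate _ v) helper)
  where
  helper : (if lookup S v then false else edge H (S ∪ ⁅ v ⁆)) ≡ true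
  helper with lookup S v in eq
  ... | true  = contradiction (lookup⇒[]= v S eq) v∉S
  ... | false = e

∈-neighbours⁻ : ∀ {H : KGraph k n} {S v} → v ∈ neighbours H S → v ∉ S × edge H (S ∪ ⁅ v ⁆) ≡ true
∈-neighbours⁻ {H = H} {S} {v} v∈ with lookup S v in eq | trans (sym (lookup∘tabulate _ v)) ([]=⇒lookup v∈)
... | false | e = (λ v∈S → case trans (sym eq) ([]=⇒lookup v∈S) of λ ()) , e

codeg≡∣neighbours∣ : ∀ (H : KGraph k n) S → codeg H S ≡ ∣ neighbours H S ∣
codeg≡∣neighbours∣ {n = n} H S = trans (cong sumₗ (map-tabulate {n = n} id _))
  (trans (list-sum {n} _) (trans (sum-cong-≗ indicator) (sum-⟦⟧ (λ v → if lookup S v then false else edge H (S ∪ ⁅ v ⁆)))))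
  where
  list-sum : ∀ {n} (f : Fin n → ℕ) → sumₗ (tabulateₗ f) ≡ sum f
  list-sum {zero}  f = refl
  list-sum {suc n} f = cong (f zero +_) (list-sum (f ∘ suc))
  indicator : ∀ v → (if lookup S v then 0 else (if edge H (S ∪ ⁅ v ⁆) then 1 else 0))
                  ≡ ⟦ if lookup S v then false else edge H (S ∪ ⁅ v ⁆) ⟧
  indicator v with lookup S v
  ... | true  = refl
  ... | false = refl

IsEmbedding : KGraph k m → KGraph k n → (Fin m → Fin n) → Set
IsEmbedding {m = m} {n} F H f = Injective _≡_ _≡_ f ×
  (∀ (S : Subset m) → edge F S ≡ true → ∀ (T : Subset n) →
    (∀ j → (j ∈ T → ∃[ i ] (i ∈ S × f i ≡ j)) × (∀ i → i ∈ S → f i ∈ T)) → edge H T ≡ true)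

isEmbedding? : ∀ (F : KGraph k m) (H : KGraph k n) f → Dec (IsEmbedding F H f)
isEmbedding? F H f =
  map′ (λ inj {x} {y} → inj x y) (λ inj x y → inj {x} {y})
       (all? λ x → all? λ y → (f x ≟ f y) →-dec (x ≟ y))
  ×-dec
  all-subsets? λ S → (edge F S ≟ᵇ true) →-dec all-subsets? λ T →
    (all? λ j → ((j ∈? T) →-dec any? (λ i → (i ∈? S) ×-dec (f i ≟ j)))
                ×-dec all? (λ i → (i ∈? S) →-dec (f i ∈? T)))
    →-dec (edge H T ≟ᵇ true)

IsEmbedding-resp-≗ : ∀ {F : KGraph k m} {H : KGraph k n} {f f′} → f ≗ f′ →
                     IsEmbedding F H f → IsEmbedding F H f′
IsEmbedding-resp-≗ f≗f′ (inj , hom) =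
  (λ eq → inj (trans (f≗f′ _) (trans eq (sym (f≗f′ _))))) ,
  λ S e T T=f′S → hom S e T λ j →
    (λ j∈T → case proj₁ (T=f′S j) j∈T of λ (i , i∈S , eq) → i , i∈S , trans (f≗f′ i) eq) ,
    (λ i i∈S → subst (_∈ T) (sym (f≗f′ i)) (proj₂ (T=f′S j) i i∈S))

-- Maps are searched through their codes in `Fin (n ^ m)`. Decoding returns a map up to pointwise
-- equality, which `IsEmbedding-resp-≗` absorbs.
_⊑?_ : ∀ (F : KGraph k m) (H : KGraph k n) → Dec (F ⊑ H)
F ⊑? H = map′
  (λ (i , emb) → finToFun i , emb)
  (λ (f , emb) → funToFin f , IsEmbedding-resp-≗ {F = F} {H} (λ i → sym (finToFun-funToFin f i)) emb)
  (any? (λ i → isEmbedding? F H (finToFun i)))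

free? : ∀ (𝓕 : Family k) (H : KGraph k n) → Dec (Free 𝓕 H)
free? 𝓕 H = map′ (λ all F F∈ → All.lookup all F∈) (λ free → All.tabulate (λ {(m , F)} F∈ → free F F∈))
                 (All.all? (λ (m , F) → ¬? (F ⊑? H)) 𝓕)

minCodegAtLeast? : ∀ (H : KGraph k n) c → Dec (MinCodegAtLeast H c)
minCodegAtLeast? {k} H c = all-subsets? λ S → (∣ S ∣ ≟ⁿ k ∸ 1) →-dec (c ≤? codeg H S)

¬minCodegAtLeast⇒atMost : ∀ (H : KGraph k n) {c} → ¬ MinCodegAtLeast H (suc c) → MinCodegAtMost H c
¬minCodegAtLeast⇒atMost {k} H {c} ¬least
  with anySubset? (λ S → (∣ S ∣ ≟ⁿ k ∸ 1) ×-dec (codeg H S ≤? c))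
... | yes most = most
... | no ¬most = contradiction (λ S ∣S∣ → ≰⇒> (λ ≤c → ¬most (S , ∣S∣ , ≤c))) ¬least

Attained : Family k → ℕ → ℕ → Set
Attained {k} 𝓕 n c = ∃[ H ] (Free 𝓕 H × MinCodegAtLeast {k} {n} H c)

attained? : ∀ (𝓕 : Family k) n c → Dec (Attained 𝓕 n c)
attained? {k} 𝓕 n c = map′ Any.satisfied to
  (Any.any? (λ H → free? 𝓕 H ×-dec minCodegAtLeast? H c) (kGraphs k n))
  where
  to : Attained 𝓕 n c → Any (λ H → Free 𝓕 H × MinCodegAtLeast H c) (kGraphs k n)
  to (H , free , least) with H′ , H′∈ , H′≈H ← kGraphs-complete H =
    lose H′∈ ((λ {m} → Free-resp-≈ {H = H} {H′} (λ S → sym (H′≈H S)) free {m}) ,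
      λ S ∣S∣ → ≤-trans (least S ∣S∣) (≤-reflexive (sym (codeg-resp-≈ {H = H′} {H} H′≈H S))))

last-true : ∀ {P : ℕ → Set} → (∀ i → Dec (P i)) → ∀ {b} → (∀ i → P i → i ≤ b) →
            ∀ {i} → P i → ∃[ c ] (i ≤ c × P c × ¬ P (suc c))
-- The fuel lasts until position `suc b`, where `bounded` refutes the predicate.
last-true {P} P? {b} bounded {i} p = go (suc b ∸ i) p (m≤n+m∸n (suc b) i)
  where
  go : ∀ fuel {j} → P j → suc b ≤ j + fuel → ∃[ c ] (j ≤ c × P c × ¬ P (suc c))
  go zero {j} pⱼ b<j = contradiction (bounded j pⱼ) (<⇒≱ (subst (suc b ≤_) (+-identityʳ j) b<j))
  go (suc fuel) {j} pⱼ b< with P? (suc j)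
  ... | no ¬p = j , ≤-refl , pⱼ , ¬p
  ... | yes p′ with c , j<c , r ← go fuel p′ (subst (suc b ≤_) (+-suc j fuel) b<) = c , <⇒≤ j<c , r

-- Decidability lets the largest attained `c` be found by search. As `suc c` is not attained, every
-- free graph has a (k-1)-set of codegree at most `c`.
coEx-exists : ∀ (𝓕 : Family k) n {b c₀} → (∀ c → Attained 𝓕 n c → c ≤ b) → Attained 𝓕 n c₀ →
              ∃[ c ] (c₀ ≤ c × CoEx 𝓕 n c)
coEx-exists 𝓕 n bounded att₀ with c , c₀≤c , att , ¬att ← last-true (attained? 𝓕 n) bounded att₀ =
  c , c₀≤c , att , λ H free → ¬minCodegAtLeast⇒atMost H (λ least → ¬att (H , (λ {m} → free {m}) , least))

-- Coloured hypergraphs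

module Coloured (k₀ q g d : ℕ) .{{_ : NonZero q}} (2≤g : 2 ≤ g) (g+d≡q : g + d ≡ q) where

  open Pattern q g d 2≤g g+d≡q

  -- This is `k - 1`, the size of the sets whose codegrees are measured; the graphs below are
  -- `suc ℓ`-uniform.
  ℓ : ℕ
  ℓ = suc (suc k₀)

  Violation : (Fin m → Fin q) → Subset m → Set
  Violation χ S = ∃[ i ] (i ∈ S × ∃[ x ] ((∀ j → j ∈ S → j ≢ i → χ j ≡ x) × Bad x (χ i)))

  violation? : ∀ (χ : Fin m → Fin q) S → Dec (Violation χ S)
  violation? χ S = any? λ i → (i ∈? S) ×-dec any? λ x →
    all? (λ j → (j ∈? S) →-dec (¬? (j ≟ i) →-dec (χ j ≟ x))) ×-dec bad? x (χ i)

  Violation-resp-≗ : ∀ {χ ψ : Fin m → Fin q} → χ ≗ ψ → ∀ {S} → Violation χ S → Violation ψ S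
  Violation-resp-≗ χ≗ψ (i , i∈S , x , mono , bad) =
    i , i∈S , x , (λ j j∈S j≢i → trans (sym (χ≗ψ j)) (mono j j∈S j≢i)) , subst (Bad x) (χ≗ψ i) bad

  -- Colourings are quantified through their codes in `Fin (q ^ m)`, which makes the property
  -- decidable and lets the family be obtained by filtering a finite list.
  Uncolourable : KGraph (suc ℓ) m → Set
  Uncolourable {m} F = ∀ (i : Fin (q ^ m)) → ∃[ S ] (edge F S ≡ true × Violation (finToFun i) S)

  uncolourable? : ∀ (F : KGraph (suc ℓ) m) → Dec (Uncolourable F)
  uncolourable? F = all? λ i → anySubset? λ S → (edge F S ≟ᵇ true) ×-dec violation? (finToFun i) S

  uncolourables : ℕ → Family (suc ℓ)
  uncolourables M = mapₗ (M ,_) (filter uncolourable? (kGraphs (suc ℓ) M))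

  uncolourables-sound : ∀ M {F : KGraph (suc ℓ) m} → (m , F) ∈ₗ uncolourables M → Uncolourable F
  uncolourables-sound M F∈ with F , F∈′ , refl ← ∈-map⁻ (M ,_) F∈ =
    proj₂ (∈-filter⁻ uncolourable? {xs = kGraphs (suc ℓ) M} F∈′)

  -- Lower bound: the residue construction.

  residueGraph : ∀ n → KGraph (suc ℓ) n
  residueGraph n .edge S = ⌊ (∣ S ∣ ≟ⁿ suc ℓ) ×-dec ¬? (violation? (residue q) S) ⌋
  residueGraph n .uniform S e with ∣ S ∣ ≟ⁿ suc ℓ
  ... | yes eq = eq

  residueGraph-edge⁺ : ∀ {S : Subset n} → ∣ S ∣ ≡ suc ℓ → ¬ Violation (residue q) S →
                       edge (residueGraph n) S ≡ true
  residueGraph-edge⁺ {S = S} ∣S∣ ¬viol with ∣ S ∣ ≟ⁿ suc ℓ | violation? (residue q) S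
  ... | yes _ | no _     = refl
  ... | yes _ | yes viol = contradiction viol ¬viol
  ... | no ≢k | _        = contradiction ∣S∣ ≢k

  residueGraph-edge⁻ : ∀ {S : Subset n} → edge (residueGraph n) S ≡ true → ¬ Violation (residue q) S
  residueGraph-edge⁻ {S = S} e with ∣ S ∣ ≟ⁿ suc ℓ | violation? (residue q) S
  ... | yes _ | no ¬viol = ¬viol

  -- An embedding pulls the residue colouring back to a colouring of `F`. Some edge of `F` violates
  -- it, and the image of that edge is a violating edge of the residue graph, which has none.
  residueGraph-free : ∀ M n → Free (uncolourables M) (residueGraph n)
  residueGraph-free M n {m} F F∈ (f , inj , hom)
    with S , e , viol ← uncolourables-sound M F∈ (funToFin (residue q ∘ f))
    with i , i∈S , x , mono , bad ← Violation-resp-≗ (finToFun-funToFin (residue q ∘ f)) viol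
    = residueGraph-edge⁻ {S = image f S}
        (hom S e (image f S) (λ j → ∈-image⁻ f S , λ i → ∈-image⁺ f))
        (f i , ∈-image⁺ f i∈S , x , mono′ , bad)
    where
    mono′ : ∀ j → j ∈ image f S → j ≢ f i → residue q j ≡ x
    mono′ j j∈ j≢ with i′ , i′∈S , refl ← ∈-image⁻ f S j∈ = mono i′ i′∈S (j≢ ∘ cong f)

  two-elements : ∀ (S : Subset n) → 2 ≤ ∣ S ∣ → ∃[ a ] ∃[ b ] (a ∈ S × b ∈ S × a ≢ b)
  two-elements S 2≤
    with a , a∈S , _ ← fresh-element {0} (λ ()) S (<⇒≤ 2≤)
    with b , b∈S , a≢b ← fresh-element {1} (λ _ → a) S 2≤
    = a , b , a∈S , b∈S , a≢b zero

  d≤∣∁B∣ : ∀ (B : Subset q) → ∣ B ∣ ≤ g → d ≤ ∣ ∁ B ∣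
  d≤∣∁B∣ B ∣B∣≤g = +-cancelˡ-≤ g d ∣ ∁ B ∣ (begin
    g + d             ≡⟨ g+d≡q ⟩
    q                 ≡⟨ ∣∁p∣+∣p∣≡n B ⟨
    ∣ ∁ B ∣ + ∣ B ∣   ≤⟨ +-monoʳ-≤ ∣ ∁ B ∣ ∣B∣≤g ⟩
    ∣ ∁ B ∣ + g       ≡⟨ +-comm ∣ ∁ B ∣ g ⟩
    g + ∣ ∁ B ∣       ∎)
    where open ≤-Reasoning

  -- If the exceptional vertex is `v`, then `S` is monochromatic. If it lies in `S`, then `v` has
  -- the common colour of all other vertices, and at least one of `a` and `b` is among these.
  violation-∪⁻ : ∀ (χ : Fin n → Fin q) {S v a b} → a ∈ S → b ∈ S → a ≢ b → v ∉ S →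
    Violation χ (S ∪ ⁅ v ⁆) →
    (∃[ x ] ((∀ {j} → j ∈ S → χ j ≡ x) × Bad x (χ v))) ⊎ (χ v ≡ χ a ⊎ χ v ≡ χ b)
  violation-∪⁻ χ {S} {v} {a} {b} a∈S b∈S a≢b v∉S (i , i∈ , x , mono , bad) with x∈p∪q⁻ S ⁅ v ⁆ i∈
  ... | inj₂ i∈v with refl ← x∈⁅y⁆⇒x≡y v i∈v =
    inj₁ (x , (λ {j} j∈S → mono j (p⊆p∪q _ j∈S) (λ { refl → v∉S j∈S })) , bad)
  ... | inj₁ i∈S with a ≟ i
  ...   | no a≢i   = inj₂ (inj₁ (trans χv≡x (sym (mono a (p⊆p∪q _ a∈S) a≢i))))
    where
    χv≡x : χ v ≡ x
    χv≡x = mono v (q⊆p∪q S _ (x∈⁅x⁆ v)) (λ { refl → v∉S i∈S })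
  ...   | yes refl = inj₂ (inj₂ (trans χv≡x (sym (mono b (p⊆p∪q _ b∈S) (a≢b ∘ sym)))))
    where
    χv≡x : χ v ≡ x
    χv≡x = mono v (q⊆p∪q S _ (x∈⁅x⁆ v)) (λ { refl → v∉S i∈S })

  -- At most `g` colours have to be excluded. If `S` is monochromatic these are the colours for
  -- which `χ a` is bad, `χ a` included; otherwise they are `χ a` and `χ b`, and `2 ≤ g` is what is
  -- needed.
  completing-colours : ∀ (χ : Fin n → Fin q) (S : Subset n) → 2 ≤ ∣ S ∣ →
    ∃[ C ] (d ≤ ∣ C ∣ × (∀ {v} → v ∉ S → χ v ∈ C → ¬ Violation χ (S ∪ ⁅ v ⁆)))
  completing-colours {n} χ S 2≤ with a , b , a∈S , b∈S , a≢b ← two-elements S 2≤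
    with all? (λ j → (j ∈? S) →-dec (χ j ≟ χ a))
  ... | yes mono = ∁ B , d≤∣∁B∣ B (∣bad∣≤g (χ a)) , valid
    where
    B : Subset q
    B = comprehension (bad? (χ a))
    ∉B : ∀ {c} → c ∈ ∁ B → ¬ Bad (χ a) c
    ∉B c∈ = x∈∁p⇒x∉p c∈ ∘ ∈-comprehension⁺ (bad? (χ a))
    valid : ∀ {v} → v ∉ S → χ v ∈ ∁ B → ¬ Violation χ (S ∪ ⁅ v ⁆)
    valid {v} v∉S χv∈ viol with violation-∪⁻ χ a∈S b∈S a≢b v∉S viol
    ... | inj₁ (x , S≡x , bad) = ∉B χv∈ (subst (λ z → Bad z (χ v)) (sym (S≡x a∈S)) bad)
    ... | inj₂ (inj₁ eq) = ∉B χv∈ (subst (Bad (χ a)) (sym eq) (bad-refl (χ a)))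
    ... | inj₂ (inj₂ eq) = ∉B χv∈ (subst (Bad (χ a)) (sym (trans eq (mono b b∈S))) (bad-refl (χ a)))
  ... | no ¬mono = ∁ B , d≤∣∁B∣ B ∣B∣≤g , valid
    where
    B : Subset q
    B = ⁅ χ a ⁆ ∪ ⁅ χ b ⁆
    ∣B∣≤g : ∣ B ∣ ≤ g
    ∣B∣≤g = ≤-trans (∣p∪q∣≤∣p∣+∣q∣ ⁅ χ a ⁆ ⁅ χ b ⁆)
      (≤-trans (≤-reflexive (cong₂ _+_ (∣⁅x⁆∣≡1 (χ a)) (∣⁅x⁆∣≡1 (χ b)))) 2≤g)
    valid : ∀ {v} → v ∉ S → χ v ∈ ∁ B → ¬ Violation χ (S ∪ ⁅ v ⁆)
    valid {v} v∉S χv∈ viol with violation-∪⁻ χ a∈S b∈S a≢b v∉S viol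
    ... | inj₁ (x , S≡x , bad) = ¬mono (λ j j∈S → trans (S≡x j∈S) (sym (S≡x a∈S)))
    ... | inj₂ (inj₁ eq) = x∈∁p⇒x∉p χv∈ (p⊆p∪q _ (subst (_∈ ⁅ χ a ⁆) (sym eq) (x∈⁅x⁆ (χ a))))
    ... | inj₂ (inj₂ eq) = x∈∁p⇒x∉p χv∈ (q⊆p∪q ⁅ χ a ⁆ _ (subst (_∈ ⁅ χ b ⁆) (sym eq) (x∈⁅x⁆ (χ b))))

  residueGraph-codeg : ∀ n → MinCodegAtLeast (residueGraph n) (n / q * d ∸ ℓ)
  residueGraph-codeg n S ∣S∣
    with C , d≤∣C∣ , valid ← completing-colours (residue q) S (≤-trans (s≤s (s≤s z≤n)) (≤-reflexive (sym ∣S∣)))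
    = m≤n+o⇒m∸n≤o _ ℓ (begin
      n / q * d                                  ≤⟨ *-monoʳ-≤ (n / q) d≤∣C∣ ⟩
      n / q * ∣ C ∣                              ≤⟨ residues-in q n C ⟩
      ∣ comprehension inC? ∣                     ≤⟨ p⊆q⇒∣p∣≤∣q∣ sub ⟩
      ∣ S ∪ neighbours (residueGraph n) S ∣      ≤⟨ ∣p∪q∣≤∣p∣+∣q∣ S _ ⟩
      ∣ S ∣ + ∣ neighbours (residueGraph n) S ∣  ≡⟨ cong₂ _+_ ∣S∣ (sym (codeg≡∣neighbours∣ (residueGraph n) S)) ⟩
      ℓ + codeg (residueGraph n) S               ∎)
    where
    open ≤-Reasoning
    inC? : ∀ (v : Fin n) → Dec (residue q v ∈ C)
    inC? v = residue q v ∈? C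
    -- Vertices of `S` may themselves have a colour in `C`, which is where `ℓ` is lost.
    sub : comprehension inC? ⊆ S ∪ neighbours (residueGraph n) S
    sub {v} v∈ with v ∈? S
    ... | yes v∈S = p⊆p∪q _ v∈S
    ... | no v∉S  = q⊆p∪q S _ (∈-neighbours⁺ {H = residueGraph n} v∉S
      (residueGraph-edge⁺ (trans (∣p∪⁅x⁆∣≡1+∣p∣ v∉S) (cong suc ∣S∣)) (valid v∉S (∈-comprehension⁻ inC? v∈))))

  -- Upper bound: forcing more and more frequent colours.

  L : ℕ
  L = q * ℓ

  -- Each of the `q ^ size j` colourings of the current vertices receives its own block of `L` new
  -- vertices.
  size : ℕ → ℕ
  size zero    = 0
  size (suc j) = q ^ size j * L + size j

  module UpperBound {n} (H : KGraph (suc ℓ) n) {c} (least : MinCodegAtLeast H c) where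

    Proper : (Fin m → Fin n) → (Fin m → Fin q) → Set
    Proper W χ = ∀ T → edge H T ≡ true → (∀ {u} → u ∈ T → ∃[ i ] W i ≡ u) →
      ¬ (∃[ i ] (W i ∈ T × ∃[ x ] ((∀ j → W j ∈ T → j ≢ i → χ j ≡ x) × Bad x (χ i))))

    Proper-∘ : ∀ {W : Fin m → Fin n} {W₀ : Fin k → Fin n} {χ : Fin m → Fin q} (f : Fin k → Fin m) →
               Injective _≡_ _≡_ W → (∀ j → W (f j) ≡ W₀ j) → Proper W χ → Proper W₀ (χ ∘ f)
    Proper-∘ {W = W} {χ = χ} f W-inj W∘f proper T e T⊆ (i , i∈T , x , mono , bad) =
      proper T e (λ u∈T → case T⊆ u∈T of λ (i′ , eq) → f i′ , trans (W∘f i′) eq)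
        (f i , subst (_∈ T) (sym (W∘f i)) i∈T , x , mono′ , bad)
      where
      mono′ : ∀ j → W j ∈ T → j ≢ f i → χ j ≡ x
      mono′ j j∈T j≢ with i′ , eq ← T⊆ j∈T
        with refl ← W-inj {f i′} {j} (trans (W∘f i′) eq) =
        mono i′ (subst (_∈ T) (sym eq) j∈T) (j≢ ∘ cong f)

    -- A vertex v of P cannot receive any colour that χ already uses ℓ times.
    Candidates : (Fin m → Fin n) → (Fin m → Fin q) → Subset n → Set
    Candidates W χ P = ∀ {v} → v ∈ P → ∀ {y} → ℓ ≤ ∣ fibre χ y ∣ →
      ∃[ S ] ∃[ x ] ((∀ {u} → u ∈ S → ∃[ i ] (W i ≡ u × χ i ≡ x)) × edge H (S ∪ ⁅ v ⁆) ≡ true × Bad x y)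

    -- The sets `N y` have total size at least `q * c`, so by the double count at least `s` vertices
    -- lie in more than `d` of them. A frequent colour `y` allows at most `d` indices whose
    -- representative is not bad for it, so one of the sets containing such a vertex comes from a
    -- bad representative.
    candidates : ∀ {W : Fin m → Fin n} → Injective _≡_ _≡_ W → ∀ χ {s} → s ≤ n →
                 n * d + q * s < q * c → ∃[ P ] (s ≤ ∣ P ∣ × Candidates W χ P)
    candidates {W = W} W-inj χ {s} s≤n s<c with nonempty? (comprehension (λ x → ℓ ≤? ∣ fibre χ x ∣))
    -- No colour is frequent, so the condition is vacuous and every vertex is a candidate.
    ... | no empty = ⊤ , ≤-trans s≤n (≤-reflexive (sym (∣⊤∣≡n n))) ,
      λ _ {y} y-large → contradiction (y , ∈-comprehension⁺ (λ x → ℓ ≤? ∣ fibre χ x ∣) y-large) empty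
    ... | yes nonempty with r , r∈T , bound ← representatives (comprehension (λ x → ℓ ≤? ∣ fibre χ x ∣)) nonempty
      = popular d N , <⇒≤ (*-cancelˡ-< q s _ (+-cancelˡ-< (n * d) _ _ (<-≤-trans s<c (∣popular∣-lower-bound d N c≤N)))) , cands
      where
      large? : ∀ x → Dec (ℓ ≤ ∣ fibre χ x ∣)
      large? x = ℓ ≤? ∣ fibre χ x ∣
      mono-set : ∀ y → ∃[ A ] (A ⊆ fibre χ (r y) × ∣ A ∣ ≡ ℓ)
      mono-set y = subset-of-size (fibre χ (r y)) (∈-comprehension⁻ large? (r∈T y))
      S : Fin q → Subset n
      S y = image W (proj₁ (mono-set y))
      N : Fin q → Subset n
      N y = neighbours H (S y)
      c≤N : ∀ y → c ≤ ∣ N y ∣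
      c≤N y = ≤-trans (least (S y) (trans (∣image∣≡∣p∣ W-inj (proj₁ (mono-set y))) (proj₂ (proj₂ (mono-set y)))))
                      (≤-reflexive (codeg≡∣neighbours∣ H (S y)))
      cands : Candidates W χ (popular d N)
      cands {v} v∈ {y} y-large
        with any? (λ z → (z ∈? indicesOf N v) ×-dec bad? (r z) y)
      ... | no ∄z = contradiction
              (bound (∈-comprehension⁺ large? y-large) (indicesOf N v) (λ z∈ bad → ∄z (_ , z∈ , bad)))
              (<⇒≱ (∈-comprehension⁻ (λ u → d <? ∣ indicesOf N u ∣) v∈))
      ... | yes (z , z∈ , bad) = S z , r z , coloured , proj₂ (∈-neighbours⁻ {H = H} (∈-indicesOf⁻ N z∈)) , bad
        where
        coloured : ∀ {u} → u ∈ S z → ∃[ i ] (W i ≡ u × χ i ≡ r z)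
        coloured u∈ with i , i∈ , eq ← ∈-image⁻ W (proj₁ (mono-set z)) u∈ =
          i , eq , ∈-fibre⁻ χ (proj₁ (proj₂ (mono-set z)) i∈)

    Rich : ℕ → (Fin m → Fin n) → Set
    Rich j W = ∀ χ → Proper W χ →
      Σ (Fin j → Fin q) λ t → Injective _≡_ _≡_ t × (∀ a → ℓ ≤ ∣ fibre χ (t a) ∣)

    rich-set : ∀ j → size j ≤ n → n * d + q * size j < q * c →
               Σ (Fin (size j) → Fin n) λ W → Injective _≡_ _≡_ W × Rich j W
    rich-set zero    _   _ = (λ ()) , (λ {x} → case x of λ ()) , λ _ _ → (λ ()) , (λ {x} → case x of λ ()) , λ ()
    rich-set (suc j) s≤n s<c
      with W , W-inj , rich ← rich-set j (≤-trans (m≤n+m _ (q ^ size j * L)) s≤n)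
             (≤-<-trans (+-monoʳ-≤ (n * d) (*-monoʳ-≤ q (m≤n+m _ (q ^ size j * L)))) s<c)
      = W′ , W′-inj , rich′
      where
      colouring : Fin (q ^ size j * L) → Fin (size j) → Fin q
      colouring i = finToFun (quotient L i)
      cand : ∀ i → ∃[ P ] (size (suc j) ≤ ∣ P ∣ × Candidates W (colouring i) P)
      cand i = candidates W-inj (colouring i) s≤n s<c
      extension : _
      extension = extend-injection (q ^ size j * L) W W-inj (proj₁ ∘ cand) (proj₁ ∘ proj₂ ∘ cand)
      W′ : Fin (size (suc j)) → Fin n
      W′ = proj₁ extension
      W′-inj : Injective _≡_ _≡_ W′
      W′-inj = proj₁ (proj₂ extension)
      old : Fin (size j) → Fin (size (suc j))
      old = (q ^ size j * L) ↑ʳ_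
      W′-old : ∀ i → W′ (old i) ≡ W i
      W′-old = proj₁ (proj₂ (proj₂ extension))

      module _ (χ : Fin (size (suc j)) → Fin q) (proper : Proper W′ χ) where
        -- This is the block reserved for the colouring that `χ` induces on the old vertices.
        new : Fin L → Fin (size (suc j))
        new l = combine (funToFin (χ ∘ old)) l ↑ˡ size j

        new-injective : Injective _≡_ _≡_ new
        new-injective {l} {l′} eq = combine-injectiveʳ (funToFin (χ ∘ old)) l _ l′ (↑ˡ-injective (size j) _ _ eq)

        colouring≗ : ∀ l → colouring (combine (funToFin (χ ∘ old)) l) ≗ χ ∘ old
        colouring≗ l i = trans (cong (λ z → finToFun (proj₁ z) i) (remQuot-combine (funToFin (χ ∘ old)) l))
                               (finToFun-funToFin (χ ∘ old) i)

        -- If this colour were frequent on the old vertices, the candidate property would give an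
        -- edge whose other vertices share a colour bad for it, contradicting `proper`.
        new-colour : ∀ l → ¬ (ℓ ≤ ∣ fibre (χ ∘ old) (χ (new l)) ∣)
        new-colour l large
          with S , x , S-coloured , e , bad ← proj₂ (proj₂ (cand (combine (funToFin (χ ∘ old)) l)))
                 (proj₂ (proj₂ (proj₂ extension)) (combine (funToFin (χ ∘ old)) l))
                 (≤-trans large (≤-reflexive (cong ∣_∣ (sym (fibre-cong (colouring≗ l) _)))))
          = proper (S ∪ ⁅ v ⁆) e covered (new l , q⊆p∪q S _ (x∈⁅x⁆ v) , x , mono , bad)
          where
          v : Fin n
          v = W′ (new l)
          covered : ∀ {u} → u ∈ S ∪ ⁅ v ⁆ → ∃[ i ] W′ i ≡ u
          covered u∈ with x∈p∪q⁻ S _ u∈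
          ... | inj₂ u∈v = new l , sym (x∈⁅y⁆⇒x≡y v u∈v)
          ... | inj₁ u∈S with i , eq , _ ← S-coloured u∈S = old i , trans (W′-old i) eq
          mono : ∀ i → W′ i ∈ S ∪ ⁅ v ⁆ → i ≢ new l → χ i ≡ x
          mono i i∈ i≢ with x∈p∪q⁻ S _ i∈
          ... | inj₂ i∈v = contradiction (W′-inj (x∈⁅y⁆⇒x≡y v i∈v)) i≢
          ... | inj₁ i∈S with i′ , eq , χi′ ← S-coloured i∈S
                with refl ← W′-inj {old i′} {i} (trans (W′-old i′) eq) = trans (sym (colouring≗ l i′)) χi′

        richer : Σ (Fin (suc j) → Fin q) λ t → Injective _≡_ _≡_ t × (∀ a → ℓ ≤ ∣ fibre χ (t a) ∣)
        richer
          with t , t-inj , t-large ← rich (χ ∘ old) (Proper-∘ old W′-inj W′-old proper)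
          -- The block has `q * ℓ` vertices, so `ℓ` of them share a colour; by `new-colour` it
          -- differs from every `t a`.
          with x , x-large ← large-fibre (suc k₀) (χ ∘ new)
          with l , l∈ , _ ← fresh-element {0} (λ ()) (fibre (χ ∘ new) x) (≤-trans (s≤s z≤n) x-large)
          = t′ , t′-inj , t′-large
          where
          x≢t : ∀ a → x ≢ t a
          x≢t a refl = new-colour l (subst (λ z → ℓ ≤ ∣ fibre (χ ∘ old) z ∣) (sym (∈-fibre⁻ (χ ∘ new) l∈)) (t-large a))
          t′ : Fin (suc j) → Fin q
          t′ zero    = x
          t′ (suc a) = t a
          t′-inj : Injective _≡_ _≡_ t′
          t′-inj {zero}  {zero}  eq = refl
          t′-inj {zero}  {suc b} eq = contradiction eq (x≢t b)
          t′-inj {suc a} {zero}  eq = contradiction (sym eq) (x≢t a)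
          t′-inj {suc a} {suc b} eq = cong suc (t-inj eq)
          t′-large : ∀ a → ℓ ≤ ∣ fibre χ (t′ a) ∣
          t′-large zero    = ≤-trans x-large (∣fibre∘∣≤ χ new-injective x)
          t′-large (suc a) = ≤-trans (t-large a) (∣fibre∘∣≤ χ (λ {i} {i′} → ↑ʳ-injective (q ^ size j * L) i i′) (t a))

      rich′ : Rich (suc j) W′
      rich′ = richer

    restriction : ∀ (W : Fin m → Fin n) → Injective _≡_ _≡_ W → KGraph (suc ℓ) m
    restriction W W-inj .edge A = edge H (image W A)
    restriction W W-inj .uniform A e = trans (sym (∣image∣≡∣p∣ W-inj A)) (uniform H (image W A) e)

    image-preimage : ∀ (W : Fin m → Fin n) T → (∀ {u} → u ∈ T → ∃[ i ] W i ≡ u) →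
                     image W (comprehension (λ i → W i ∈? T)) ≡ T
    image-preimage {m} W T T⊆ = ⊆-antisym
      (λ u∈ → case ∈-image⁻ W (comprehension W∈T?) u∈ of λ { (i , i∈ , refl) → ∈-comprehension⁻ W∈T? i∈ })
      (λ u∈T → case T⊆ u∈T of λ { (i , refl) → ∈-image⁺ W (∈-comprehension⁺ W∈T? u∈T) })
      where
      W∈T? : ∀ (i : Fin m) → Dec (W i ∈ T)
      W∈T? i = W i ∈? T

    restriction-uncolourable : ∀ (W : Fin m → Fin n) (W-inj : Injective _≡_ _≡_ W) →
      (∀ χ → ¬ Proper W χ) → Uncolourable (restriction W W-inj)
    restriction-uncolourable W W-inj improper i
      with anySubset? (λ A → (edge H (image W A) ≟ᵇ true) ×-dec violation? (finToFun i) A)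
    ... | yes ∃A = ∃A
    ... | no ∄A = contradiction proper (improper (finToFun i))
      where
      proper : Proper W (finToFun i)
      proper T e T⊆ (i , i∈T , x , mono , bad) = ∄A
        ( comprehension W∈T?
        , trans (cong (edge H) (image-preimage W T T⊆)) e
        , i , ∈-comprehension⁺ W∈T? i∈T , x , (λ j j∈ → mono j (∈-comprehension⁻ W∈T? j∈)) , bad )
        where
        W∈T? : ∀ (i : Fin _) → Dec (W i ∈ T)
        W∈T? i = W i ∈? T

    -- The graph induced on `W` is uncolourable. Its copy `F` in the enumeration belongs to the
    -- family, and `W` embeds it in `H`.
    improper⇒¬free : ∀ (W : Fin m → Fin n) → Injective _≡_ _≡_ W → (∀ χ → ¬ Proper W χ) →
                     ¬ Free (uncolourables m) H
    improper⇒¬free {m} W W-inj improper free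
      with F , F∈ , F≈ ← kGraphs-complete (restriction W W-inj)
      = free F (∈-map⁺ (m ,_) (∈-filter⁺ uncolourable? F∈ F-uncolourable))
          (W , W-inj , λ S e T T=WS → trans (cong (edge H) (T≡ S T T=WS)) (trans (sym (F≈ S)) e))
      where
      F-uncolourable : Uncolourable F
      F-uncolourable i with S , e , viol ← restriction-uncolourable W W-inj improper i =
        S , trans (F≈ S) e , viol
      T≡ : ∀ S T → (∀ j → (j ∈ T → ∃[ i ] (i ∈ S × W i ≡ j)) × (∀ i → i ∈ S → W i ∈ T)) → T ≡ image W S
      T≡ S T T=WS = ⊆-antisym
        (λ {j} j∈T → case proj₁ (T=WS j) j∈T of λ { (i , i∈S , refl) → ∈-image⁺ W i∈S })
        (λ {j} j∈ → case ∈-image⁻ W S j∈ of λ { (i , i∈S , refl) → proj₂ (T=WS j) i i∈S })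

    -- A proper colouring would use `suc q` distinct colours out of `q`.
    rich⇒improper : ∀ {W : Fin m → Fin n} → Rich (suc q) W → ∀ χ → ¬ Proper W χ
    rich⇒improper rich χ proper with t , t-inj , _ ← rich χ proper
      with i , j , i<j , eq ← pigeonhole (n<1+n q) t = <⇒≢ i<j (cong toℕ (t-inj eq))

    contains-uncolourable : size (suc q) ≤ n → n * d + q * size (suc q) < q * c →
                            ¬ Free (uncolourables (size (suc q))) H
    contains-uncolourable s≤n s<c = improper⇒¬free (proj₁ W) (proj₁ (proj₂ W)) (rich⇒improper (proj₂ (proj₂ W)))
      where
      W : Σ (Fin (size (suc q)) → Fin n) λ W → Injective _≡_ _≡_ W × Rich (suc q) W
      W = rich-set (suc q) s≤n s<c

  -- Two-sided bounds on the codegree Turán number.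

  M K : ℕ
  M = size (suc q)
  -- One error constant serves both directions: `M` covers the upper bound, and in the lower bound
  -- `d` pays for rounding `n / q` and `ℓ` for the vertices of the (k-1)-set.
  K = M + (d + ℓ)

  coEx-bounds : ∀ n → M ≤ n → ∃[ c ] (CoEx (uncolourables M) n c × q * c ≤ n * d + q * K × n * d ≤ q * c + q * K)
  coEx-bounds n M≤n = bounds (coEx-exists (uncolourables M) n bounded attained)
    where
    open ≤-Reasoning
    upper : ∀ c → Attained (uncolourables M) n c → q * c ≤ n * d + q * M
    upper c (H , free , least) = ≮⇒≥ λ s<c → UpperBound.contains-uncolourable H least M≤n s<c free
    bounded : ∀ c → Attained (uncolourables M) n c → c ≤ n * d + q * M
    bounded c att = ≤-trans (m≤n*m c q) (upper c att)
    attained : Attained (uncolourables M) n (n / q * d ∸ ℓ)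
    attained = residueGraph n , (λ {m} → residueGraph-free M n {m}) , residueGraph-codeg n
    lower : ∀ {c} → n / q * d ∸ ℓ ≤ c → n * d ≤ q * c + q * K
    lower {c} c₀≤c = begin
      n * d                             ≡⟨ cong (_* d) (m≡m%n+[m/n]*n n q) ⟩
      (n % q + n / q * q) * d           ≤⟨ *-monoˡ-≤ d (+-monoˡ-≤ (n / q * q) (<⇒≤ (m%n<n n q))) ⟩
      (q + n / q * q) * d               ≡⟨ solve 3 (λ q t d → (q :+ t :* q) :* d := q :* (d :+ t :* d)) refl q (n / q) d ⟩
      q * (d + n / q * d)               ≤⟨ *-monoʳ-≤ q (+-monoʳ-≤ d (≤-trans (m≤n+m∸n (n / q * d) ℓ) (+-monoʳ-≤ ℓ c₀≤c))) ⟩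
      q * (d + (ℓ + c))                 ≡⟨ solve 4 (λ q d l c → q :* (d :+ (l :+ c)) := q :* c :+ q :* (d :+ l)) refl q d ℓ c ⟩
      q * c + q * (d + ℓ)               ≤⟨ +-monoʳ-≤ (q * c) (*-monoʳ-≤ q (m≤n+m (d + ℓ) M)) ⟩
      q * c + q * K                     ∎
    bounds : ∃[ c ] (n / q * d ∸ ℓ ≤ c × CoEx (uncolourables M) n c) →
             ∃[ c ] (CoEx (uncolourables M) n c × q * c ≤ n * d + q * K × n * d ≤ q * c + q * K)
    bounds (c , c₀≤c , coEx) = c , coEx ,
      ≤-trans (upper c (proj₁ coEx)) (+-monoʳ-≤ (n * d) (*-monoʳ-≤ q (m≤m+n M _))) , lower c₀≤c

-- From integer bounds to the rational limit.

halve : ∀ {x y z} → (x + x) ≤ (y + y) + (z + z) → x ≤ y + z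
halve {x} {y} {z} le = *-cancelˡ-≤ 2 (begin
  2 * x               ≡⟨ cong (x +_) (+-identityʳ x) ⟩
  x + x               ≤⟨ le ⟩
  (y + y) + (z + z)   ≡⟨ solve 2 (λ y z → (y :+ y) :+ (z :+ z) := con 2 :* (y :+ z)) refl y z ⟩
  2 * (y + z)         ∎)
  where open ≤-Reasoning

open import Data.Integer using (+_; -[1+_]; +[1+_]; +<+; _⊖_) renaming (∣_∣ to ∣_∣ℤ; _+_ to _+ℤ_; _*_ to _*ℤ_; -_ to -ℤ_)
import Data.Integer.Properties as ℤ
open import Data.Rational using (ℚ; mkℚ; 0ℚ; 1ℚ; toℚᵘ; _-_; *≤*; *<*) renaming (_≤_ to _≤ℚ_; _<_ to _<ℚ_; ∣_∣ to ∣_∣ℚ; _/_ to _/ℚ_; -_ to -ℚ_)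
import Data.Rational.Properties as ℚ
open import Data.Rational.Unnormalised as ℚᵘ using (mkℚᵘ)
import Data.Rational.Unnormalised.Properties as ℚᵘ
open import Data.Nat.Coprimality using (Coprime)

∣m⊖n∣≤ : ∀ {m n o} → m ≤ n + o → n ≤ m + o → ∣ m ⊖ n ∣ℤ ≤ o
∣m⊖n∣≤ {m} {n} {o} m≤ n≤ with ≤-total m n
... | inj₁ m≤n = ≤-trans (≤-reflexive (ℤ.∣⊖∣-≤ m≤n)) (m≤n+o⇒m∸n≤o n m n≤)
... | inj₂ n≤m = ≤-trans (≤-reflexive (trans (ℤ.∣m⊖n∣≡∣n⊖m∣ m n) (ℤ.∣⊖∣-≤ n≤m))) (m≤n+o⇒m∸n≤o m n m≤)

-- The difference of the fractions has numerator at most `b * K` over `suc m * b`, so it is at most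
-- `K / suc m`. This is below `1 / f`, hence below the given `suc e / f`.
fraction-close : ∀ {c m a b-1 K e f-1} .{a⊥b : Coprime a (suc b-1)} .{e⊥f : Coprime (suc e) (suc f-1)} →
  suc b-1 * c ≤ suc m * a + suc b-1 * K → suc m * a ≤ suc b-1 * c + suc b-1 * K → K * suc f-1 < suc m →
  ∣ ((+ c) /ℚ suc m) - mkℚ (+ a) b-1 a⊥b ∣ℚ <ℚ mkℚ +[1+ e ] f-1 e⊥f
fraction-close {c} {m} {a} {b-1} {K} {e} {f-1} {a⊥b} {e⊥f} c≤ a≤ small =
  ℚ.toℚᵘ-cancel-< (ℚᵘ.<-respˡ-≃ (ℚᵘ.≃-sym {toℚᵘ ∣ p - α ∣ℚ} {_} ∣p-α∣≃) (ℚᵘ.*<* (subst₂ Data.Integer._<_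
    (ℤ.pos-* ∣ num ∣ℤ f) (ℤ.pos-* (suc e) (suc m * b)) (+<+ num<))))
  where
  b f : ℕ
  b = suc b-1
  f = suc f-1
  p α : ℚ
  p = (+ c) /ℚ suc m
  α = mkℚ (+ a) b-1 a⊥b
  num : Data.Integer.ℤ
  num = (+ c) *ℤ (+ b) +ℤ (-ℤ (+ a)) *ℤ (+ suc m)
  p-α≃ : toℚᵘ (p - α) ℚᵘ.≃ mkℚᵘ (+ c) m ℚᵘ.- mkℚᵘ (+ a) b-1
  p-α≃ = ℚᵘ.≃-trans (ℚ.toℚᵘ-homo-+ p (-ℚ α))
    (ℚᵘ.+-cong (ℚ.toℚᵘ-fromℚᵘ (mkℚᵘ (+ c) m)) (ℚ.toℚᵘ-homo‿- α))
  ∣p-α∣≃ : toℚᵘ ∣ p - α ∣ℚ ℚᵘ.≃ ℚᵘ.∣ mkℚᵘ (+ c) m ℚᵘ.- mkℚᵘ (+ a) b-1 ∣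
  ∣p-α∣≃ = ℚᵘ.≃-trans (ℚ.toℚᵘ-homo-∣-∣ (p - α)) (ℚᵘ.∣-∣-cong p-α≃)
  num≡ : num ≡ (b * c) ⊖ (suc m * a)
  num≡ = trans (cong₂ _+ℤ_ (trans (sym (ℤ.pos-* c b)) (cong +_ (*-comm c b)))
      (trans (sym (ℤ.neg-distribˡ-* (+ a) (+ suc m))) (cong -ℤ_ (trans (sym (ℤ.pos-* a (suc m))) (cong +_ (*-comm a (suc m)))))))
    (ℤ.m-n≡m⊖n (b * c) (suc m * a))
  num< : ∣ num ∣ℤ * f < suc e * (suc m * b)
  num< = begin-strict
    ∣ num ∣ℤ * f              ≡⟨ cong (λ z → ∣ z ∣ℤ * f) num≡ ⟩
    ∣ (b * c) ⊖ (suc m * a) ∣ℤ * f ≤⟨ *-monoˡ-≤ f (∣m⊖n∣≤ c≤ a≤) ⟩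
    b * K * f                 ≡⟨ *-assoc b K f ⟩
    b * (K * f)               <⟨ *-monoʳ-< b small ⟩
    b * suc m                     ≡⟨ *-comm b (suc m) ⟩
    suc m * b                     ≤⟨ m≤n*m (suc m * b) (suc e) ⟩
    suc e * (suc m * b)           ∎
    where open ≤-Reasoning

theorem1p1 : (k : ℕ) → 3 ≤ k → (α : ℚ) → 0ℚ ≤ℚ α → α <ℚ 1ℚ →
    Σ (Family k) λ 𝓕 →
    ∀ (ε : ℚ) → 0ℚ <ℚ ε →
    ∃[ N ] (∀ (m : ℕ) → N ≤ suc m →
    ∃[ c ] (CoEx 𝓕 (suc m) c × ∣ ((+ c) /ℚ suc m) - α ∣ℚ <ℚ ε))
theorem1p1 (suc (suc (suc k₀))) (s≤s (s≤s (s≤s z≤n))) (mkℚ -[1+ _ ] _ _) (*≤* ()) _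
theorem1p1 (suc (suc (suc k₀))) (s≤s (s≤s (s≤s z≤n))) (mkℚ (+ a) b-1 a⊥b) _ (*<* a<b) =
  uncolourables M , λ where
    -- Beyond this threshold there are at least `M` vertices, as `coEx-bounds` requires, and more
    -- than `K * suc f-1`, as `fraction-close` requires.
    (mkℚ +[1+ e ] f-1 _) _ → suc (M + K * suc f-1) , λ m N≤ →
      approximation (≤-<-trans (m≤n+m (K * suc f-1) M) N≤)
        (coEx-bounds (suc m) (≤-trans (m≤m+n M (K * suc f-1)) (<⇒≤ N≤)))
    (mkℚ (+ 0) _ _) (*<* (+<+ ()))
    (mkℚ -[1+ _ ] _ _) (*<* ())
  where
  b : ℕ
  b = suc b-1
  a<b′ : a < b
  a<b′ = ℤ.drop‿+<+ (subst₂ Data.Integer._<_ (ℤ.*-identityʳ (+ a)) (ℤ.*-identityˡ (+ b)) a<b)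
  1≤b∸a : 1 ≤ b ∸ a
  1≤b∸a = m<n⇒0<n∸m a<b′
  sum≡ : (b ∸ a + (b ∸ a)) + (a + a) ≡ b + b
  sum≡ = trans (solve 2 (λ x a → (x :+ x) :+ (a :+ a) := (x :+ a) :+ (x :+ a)) refl (b ∸ a) a)
               (cong (λ z → z + z) (m∸n+n≡m (<⇒≤ a<b′)))
  -- Doubling numerator and denominator keeps the ratio and ensures that `g` is at least 2.
  open Coloured k₀ (b + b) (b ∸ a + (b ∸ a)) (a + a) (+-mono-≤ 1≤b∸a 1≤b∸a) sum≡

  approximation : ∀ {m e f-1} .{e⊥f : Coprime (suc e) (suc f-1)} → K * suc f-1 < suc m →
    ∃[ c ] (CoEx (uncolourables M) (suc m) c ×
            (b + b) * c ≤ suc m * (a + a) + (b + b) * K × suc m * (a + a) ≤ (b + b) * c + (b + b) * K) →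
    ∃[ c ] (CoEx (uncolourables M) (suc m) c ×
            ∣ ((+ c) /ℚ suc m) - mkℚ (+ a) b-1 a⊥b ∣ℚ <ℚ mkℚ +[1+ e ] f-1 e⊥f)
  approximation {m} small (c , coEx , upper , lower) = c , coEx , fraction-close {c} {m} {a} {b-1} {K}
    -- The bounds arrive with modulus `b + b` and numerator `a + a`; halving returns them to
    -- `a / b`.
    (halve {b * c} {suc m * a} {b * K}
      (subst₂ _≤_ (*-distribʳ-+ c b b) (cong₂ _+_ (*-distribˡ-+ (suc m) a a) (*-distribʳ-+ K b b)) upper))
    (halve {suc m * a} {b * c} {b * K}
      (subst₂ _≤_ (*-distribˡ-+ (suc m) a a) (cong₂ _+_ (*-distribʳ-+ c b b) (*-distribʳ-+ K b b)) lower))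
    small
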